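{- Let $D_0$ be the edge-ordered graph on the four vertices $a,b,v,w$ with exactly the five edges $ab,av,aw,bw,bv$, ordered by $l(ab)<l(av)<l(aw)<l(bw)<l(bv)$. Then \[ssat_e(n,D_0)\ \le\ sat_e(n,D_0)=O\left(n\,\frac{\log n}{\log\log n}\right).\]
   Context: An edge-ordered graph is a finite simple graph together with a linear order on its edge set given by an injective labeling $l$ to $\mathbb{N}$ or $\mathbb{R}$. An edge-ordered graph $H$ contains $G$ (has a copy of $G$) if $G$ is isomorphic, by an isomorphism respecting the edge-order, to a subgraph of $H$ with the induced order; otherwise $H$ is $G$-free. $ssat_e(n,G)$ is the minimum number of edges in an edge-ordered graph $H$ on $n$ vertices such that adding to $H$ any missing edge, inserted at an arbitrary position of the linear order of the edges, creates a new copy of $G$ (one using the added edge); that is, for every missing edge and every position a new copy is created. $sat_e(n,G)$ is defined in the same way with the additional requirement that $H$ is $G$-free. Asymptotic notation is for $n\to\infty$. -}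

module Defs where

open import Data.Bool using (Bool; T)
open import Data.Bool.Properties using (T?)
open import Data.Fin using (Fin)
import Data.Fin.Properties as Fin
open import Data.List using (length; filter; cartesianProduct; allFin)
open import Data.Nat using (ℕ; _*_; _≤_; _<_; _<ᵇ_)
import Data.Nat.Properties as ℕ
open import Data.Nat.Logarithm using (⌊log₂_⌋)
open import Data.Product using (_×_; _,_; ∃-syntax; Σ-syntax)
open import Data.Sum using (_⊎_)
open import Data.Vec using (Vec; []; _∷_; lookup)
open import Function.Bundles using (_⇔_)
open import Function.Definitions using (Injective)
open import Relation.Binary.Definitions using (Symmetric; Irreflexive)
open import Relation.Binary.PropositionalEquality using (_≡_; _≢_; refl)
open import Relation.Nullary using (¬_; Dec)
open import Relation.Nullary.Decidable using (_×-dec_; _⊎-dec_; _→-dec_; from-yes; ¬?)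
open import Relation.Unary using (Pred)
open import Level using (0ℓ)

SamePair : ∀ {n} → Fin n → Fin n → Fin n → Fin n → Set
SamePair i j k l = (i ≡ k × j ≡ l) ⊎ (i ≡ l × j ≡ k)

-- The label of a non-adjacent pair carries no meaning, and only the order of
-- the labels of edges is ever used.
record EdgeOrderedGraph (n : ℕ) : Set where
  field
    adj   : Fin n → Fin n → Bool
    label : Fin n → Fin n → ℕ

  _~_ : Fin n → Fin n → Set
  i ~ j = T (adj i j)

  field
    ~-sym     : Symmetric _~_
    ~-irrefl  : Irreflexive _≡_ _~_
    label-sym : ∀ {i j} → i ~ j → label i j ≡ label j i
    label-inj : ∀ {i j k l} → i ~ j → k ~ l → label i j ≡ label k l → SamePair i j k l

open EdgeOrderedGraph using (label)

Adjacent : ∀ {n} → EdgeOrderedGraph n → Fin n → Fin n → Set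
Adjacent = EdgeOrderedGraph._~_

numEdges : ∀ {n} → EdgeOrderedGraph n → ℕ
numEdges {n} H =
  length (filter (λ (i , j) → (i Fin.<? j) ×-dec T? (EdgeOrderedGraph.adj H i j))
                 (cartesianProduct (allFin n) (allFin n)))

-- Copies need not be induced: non-edges of G may be sent to edges of H.
record Copy {k n} (G : EdgeOrderedGraph k) (H : EdgeOrderedGraph n) : Set where
  field
    to        : Fin k → Fin n
    injective : Injective _≡_ _≡_ to
    edges     : ∀ {i j} → Adjacent G i j → Adjacent H (to i) (to j)
    order     : ∀ {i j i′ j′} → Adjacent G i j → Adjacent G i′ j′ →
                label G i j < label G i′ j′ ⇔
                label H (to i) (to j) < label H (to i′) (to j′)

Free : ∀ {k n} → EdgeOrderedGraph k → EdgeOrderedGraph n → Set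
Free G H = ¬ Copy G H

Uses : ∀ {k n} {G : EdgeOrderedGraph k} {H : EdgeOrderedGraph n} →
       Copy G H → Fin n → Fin n → Set
Uses {G = G} c u v = ∃[ i ] ∃[ j ] (Adjacent G i j × Copy.to c i ≡ u × Copy.to c j ≡ v)

-- H′ arises from H by inserting uv somewhere in the linear order of the edges.
-- As every finite linear order embeds in ℕ, letting H′ vary gives all positions.
record Insertion {n} (H : EdgeOrderedGraph n) (u v : Fin n) (H′ : EdgeOrderedGraph n) : Set where
  field
    edges : ∀ i j → Adjacent H′ i j ⇔ (Adjacent H i j ⊎ SamePair i j u v)
    order : ∀ {i j i′ j′} → Adjacent H i j → Adjacent H i′ j′ →
            label H i j < label H i′ j′ ⇔ label H′ i j < label H′ i′ j′

Semisaturated : ∀ {k n} → EdgeOrderedGraph k → EdgeOrderedGraph n → Set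
Semisaturated G H =
  ∀ u v → u ≢ v → ¬ Adjacent H u v →
  ∀ H′ → Insertion H u v H′ → Σ[ c ∈ Copy G H′ ] Uses c u v

Saturated : ∀ {k n} → EdgeOrderedGraph k → EdgeOrderedGraph n → Set
Saturated G H = Free G H × Semisaturated G H

IsMinNumEdges : ∀ {n} → Pred (EdgeOrderedGraph n) 0ℓ → ℕ → Set
IsMinNumEdges P m = (∃[ H ] (P H × numEdges H ≡ m)) × (∀ H → P H → m ≤ numEdges H)

Is-ssatₑ : ∀ {k} → ℕ → EdgeOrderedGraph k → ℕ → Set
Is-ssatₑ n G = IsMinNumEdges {n} (Semisaturated G)

Is-satₑ : ∀ {k} → ℕ → EdgeOrderedGraph k → ℕ → Set
Is-satₑ n G = IsMinNumEdges {n} (Saturated G)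

-- f(n) = O(n log n / log log n), cleared of the denominator.  For n ≥ 4 both
-- ⌊log₂ n⌋ and ⌊log₂ ⌊log₂ n⌋⌋ = ⌊log₂ log₂ n⌋ are positive, and rounding or
-- changing the base of the logarithm only affects the constant C.
IsO[n·log/loglog] : (ℕ → ℕ) → Set
IsO[n·log/loglog] f =
  ∃[ C ] ∃[ N ] ∀ n → N ≤ n → f n * ⌊log₂ ⌊log₂ n ⌋ ⌋ ≤ C * (n * ⌊log₂ n ⌋)

-- Rows and columns are indexed by a, b, v, w; the entry 0 marks a non-edge.
D₀-labels : Vec (Vec ℕ 4) 4
D₀-labels = (0 ∷ 1 ∷ 2 ∷ 3 ∷ [])
          ∷ (1 ∷ 0 ∷ 5 ∷ 4 ∷ [])
          ∷ (2 ∷ 5 ∷ 0 ∷ 0 ∷ [])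
          ∷ (3 ∷ 4 ∷ 0 ∷ 0 ∷ [])
          ∷ []

D₀ : EdgeOrderedGraph 4
D₀ = record
  { adj       = λ i j → 0 <ᵇ l i j
  ; label     = l
  ; ~-sym     = λ {i} {j} → symm i j
  ; ~-irrefl  = λ { {i} refl → irrefl i }
  ; label-sym = λ {i} {j} _ → l-sym i j
  ; label-inj = λ {i} {j} {i′} {j′} → inj i j i′ j′
  }
  where
  l : Fin 4 → Fin 4 → ℕ
  l i j = lookup (lookup D₀-labels i) j

  E : Fin 4 → Fin 4 → Set
  E i j = T (0 <ᵇ l i j)

  E? : ∀ i j → Dec (E i j)
  E? i j = T? (0 <ᵇ l i j)

  l-sym : ∀ i j → l i j ≡ l j i
  l-sym = from-yes (Fin.all? λ i → Fin.all? λ j → l i j ℕ.≟ l j i)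

  symm : ∀ i j → E i j → E j i
  symm = from-yes (Fin.all? λ i → Fin.all? λ j → E? i j →-dec E? j i)

  irrefl : ∀ i → ¬ E i i
  irrefl = from-yes (Fin.all? λ i → ¬? (E? i i))

  inj : ∀ i j i′ j′ → E i j → E i′ j′ → l i j ≡ l i′ j′ → SamePair i j i′ j′
  inj = from-yes (Fin.all? λ i → Fin.all? λ j → Fin.all? λ i′ → Fin.all? λ j′ →
    E? i j →-dec E? i′ j′ →-dec (l i j ℕ.≟ l i′ j′) →-dec
    (((i Fin.≟ i′) ×-dec (j Fin.≟ j′)) ⊎-dec ((i Fin.≟ j′) ×-dec (j Fin.≟ i′))))

{-# OPTIONS --safe #-}
module Submission where

-- Take vertices p, q and a set of columns, join all of them to every vertex of an
-- independent set X, and add the edge pq.  The least labels are those of the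
-- edges px, then comes pq, and then for each x in turn a block holding first qx
-- and then the edges from x to the columns, in an order key x depending on x.
-- Every triangle contains pq, which is the least edge of no triangle, so there is no D₀.
-- Let x precede y and add xy.  If its label exceeds that of qx, then p, x, y, q
-- play a, b, v, w.  Otherwise x, y play a, b, and any two columns on which key x
-- and key y disagree play v, w.  So X stays independent in any D₀-free graph extending
-- this one, and a saturated extension has at most n edges per vertex outside X.
-- Distinct orders for n vertices are available already with O(log n / log log n) columns.

open import Defs
open import Data.Bool using (Bool; true; false; T)
open import Data.Bool.Properties using (T?)
open import Data.Empty using (⊥; ⊥-elim)
open import Data.Fin using (Fin; zero; suc; toℕ; fromℕ<; inject≤; combine; remQuot; finToFun; funToFin;
  splitAt; join)
open import Data.Fin.Patterns using (0F; 1F; 2F; 3F)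
import Data.Fin.Properties as Fin
open import Data.List using (List; []; _∷_; _++_; map; length; filter; cartesianProduct; allFin; tabulate)
open import Data.List.Membership.Propositional using (_∈_)
open import Data.List.Membership.Propositional.Properties using (∈-cartesianProduct⁺; ∈-allFin)
open import Data.List.Properties
  using (length-filter; length-map; length-++; length-tabulate; filter-++; filter-none; filter-≐)
import Data.List.Relation.Unary.All as All
import Data.List.Relation.Unary.All.Properties as All
open import Data.List.Relation.Unary.Any using (here; there)
open import Data.Maybe using (Maybe; just; nothing)
open import Data.Nat
  using (ℕ; zero; suc; _+_; _*_; _^_; _≤_; _<_; _<ᵇ_; z≤n; s≤s; z<s; s<s⁻¹;
         ⌊_/2⌋; NonZero; >-nonZero)
open import Data.Nat.DivMod using (_/_; _%_; m≡m%n+[m/n]*n; m/n*n≤m; m%n<n)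
open import Data.Nat.Induction using (<-rec)
open import Data.Nat.Logarithm using (⌊log₂_⌋; ⌊log₂⌋-mono-≤; ⌊log₂[2^n]⌋≡n; ⌊log₂⌊n/2⌋⌋≡⌊log₂n⌋∸1)
open import Data.Nat.Properties as ℕ
  using (≤-refl; ≤-reflexive; ≤-trans; <-irrefl; <-asym; <-trans; ≤-<-trans;
         <⇒≤; <⇒≱; <-cmp; m≤n⇒m≤1+n; m≤m+n; module ≤-Reasoning)
open import Data.Nat.Solver using (module +-*-Solver)
open import Data.Product using (_×_; _,_; proj₁; proj₂; uncurry; ∃; ∃-syntax; Σ-syntax)
open import Data.Sum using (_⊎_; inj₁; inj₂; [_,_]′; map₁)
open import Data.Unit using (⊤; tt)
open import Data.Vec as Vec using (lookup)
open import Function using (_∘_; id)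
open import Function.Bundles using (_⇔_; mk⇔; Equivalence)
open import Function.Definitions using (Injective)
open import Level using (0ℓ)
open import Relation.Binary.Definitions using (tri<; tri≈; tri>)
open import Relation.Binary.PropositionalEquality
open import Relation.Nullary using (¬_; Dec; yes; no; contradiction)
open import Relation.Nullary.Decidable using (_×-dec_; _⊎-dec_; _→-dec_; ¬?; map′; decidable-stable)
open import Relation.Unary using (Pred; Decidable; _⊆_)

open EdgeOrderedGraph using (label)
open Equivalence using (to; from)

private variable
  k n : ℕ
  G H K K′ : EdgeOrderedGraph n

-- Extension and equivalence of edge-ordered graphs.

infix 4 _⊑_ _≈_

-- Labels may change from `H` to `K`; only the relative order of the edges of `H` is kept, and this
-- is all that copies and insertions depend on.
record _⊑_ (H K : EdgeOrderedGraph n) : Set where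
  field
    edges : ∀ {i j} → Adjacent H i j → Adjacent K i j
    order : ∀ {i j i′ j′} → Adjacent H i j → Adjacent H i′ j′ →
            label H i j < label H i′ j′ ⇔ label K i j < label K i′ j′

_≈_ : EdgeOrderedGraph n → EdgeOrderedGraph n → Set
H ≈ K = H ⊑ K × K ⊑ H

⇔-trans : {A B C : Set} → A ⇔ B → B ⇔ C → A ⇔ C
⇔-trans f g = mk⇔ (to g ∘ to f) (from f ∘ from g)

_⇔?_ : {A B : Set} → Dec A → Dec B → Dec (A ⇔ B)
a? ⇔? b? = map′ (λ (f , g) → mk⇔ f g) (λ e → to e , from e) ((a? →-dec b?) ×-dec (b? →-dec a?))

⊑-refl : H ⊑ H
⊑-refl = record { edges = id ; order = λ _ _ → mk⇔ id id }

⊑-trans : H ⊑ K → K ⊑ K′ → H ⊑ K′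
⊑-trans p q = record
  { edges = q.edges ∘ p.edges
  ; order = λ e e′ → ⇔-trans (p.order e e′) (q.order (p.edges e) (p.edges e′))
  }
  where
  module p = _⊑_ p
  module q = _⊑_ q

≈-sym : H ≈ K → K ≈ H
≈-sym (p , q) = q , p

adjacent? : (H : EdgeOrderedGraph n) → ∀ i j → Dec (Adjacent H i j)
adjacent? H i j = T? (EdgeOrderedGraph.adj H i j)

samePair? : ∀ (i j k l : Fin n) → Dec (SamePair i j k l)
samePair? i j k l =
  ((i Fin.≟ k) ×-dec (j Fin.≟ l)) ⊎-dec ((i Fin.≟ l) ×-dec (j Fin.≟ k))

order? : (H : EdgeOrderedGraph k) (K : EdgeOrderedGraph n) (f : Fin k → Fin n) →
         Dec (∀ i j i′ j′ → Adjacent H i j → Adjacent H i′ j′ →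
              label H i j < label H i′ j′ ⇔ label K (f i) (f j) < label K (f i′) (f j′))
order? H K f = Fin.all? λ i → Fin.all? λ j → Fin.all? λ i′ → Fin.all? λ j′ →
  adjacent? H i j →-dec (adjacent? H i′ j′ →-dec
  ((label H i j ℕ.<? label H i′ j′) ⇔? (label K (f i) (f j) ℕ.<? label K (f i′) (f j′))))

_⊑?_ : (H K : EdgeOrderedGraph n) → Dec (H ⊑ K)
H ⊑? K = map′
  (λ (e , o) → record { edges = e _ _ ; order = o _ _ _ _ })
  (λ p → (λ _ _ → _⊑_.edges p) , (λ _ _ _ _ → _⊑_.order p))
  ((Fin.all? λ i → Fin.all? λ j → adjacent? H i j →-dec adjacent? K i j)
   ×-dec order? H K id)

insertion? : (H : EdgeOrderedGraph n) (u v : Fin n) (K : EdgeOrderedGraph n) → Dec (Insertion H u v K)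
insertion? H u v K = map′
  (λ (e , o) → record { edges = e ; order = o _ _ _ _ })
  (λ p → Insertion.edges p , λ _ _ _ _ → Insertion.order p)
  ((Fin.all? λ i → Fin.all? λ j →
      adjacent? K i j ⇔? (adjacent? H i j ⊎-dec samePair? i j u v))
   ×-dec order? H K id)

insertion-⊑ : ∀ {u v} → Insertion H u v K → H ⊑ K
insertion-⊑ ins = record
  { edges = λ e → from (Insertion.edges ins _ _) (inj₁ e)
  ; order = Insertion.order ins
  }

insertion-edge : ∀ {u v} → Insertion H u v K → Adjacent K u v
insertion-edge ins = from (Insertion.edges ins _ _) (inj₂ (inj₁ (refl , refl)))

insertion-resp-≈ : ∀ {u v} → H ≈ K′ → Insertion H u v K → Insertion K′ u v K
insertion-resp-≈ (p , q) ins = record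
  { edges = λ i j → mk⇔
      (λ e → map₁ p.edges (to (Insertion.edges ins i j) e))
      (λ e → from (Insertion.edges ins i j) (map₁ q.edges e))
  ; order = λ e e′ → ⇔-trans (q.order e e′) (Insertion.order ins (q.edges e) (q.edges e′))
  }
  where
  module p = _⊑_ p
  module q = _⊑_ q

insertion-≈ : ∀ {u v} → K ≈ K′ → Insertion H u v K → Insertion H u v K′
insertion-≈ (p , q) ins = record
  { edges = λ i j → ⇔-trans (mk⇔ q.edges p.edges) (Insertion.edges ins i j)
  ; order = λ e e′ → ⇔-trans (i.order e e′) (p.order (i.edges e) (i.edges e′))
  }
  where
  module p = _⊑_ p
  module q = _⊑_ q
  module i = _⊑_ (insertion-⊑ ins)

copy-⊑ : H ⊑ K → Copy G H → Copy G K
copy-⊑ p c = record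
  { to        = c.to
  ; injective = c.injective
  ; edges     = p.edges ∘ c.edges
  ; order     = λ e e′ → ⇔-trans (c.order e e′) (p.order (c.edges e) (c.edges e′))
  }
  where
  module p = _⊑_ p
  module c = Copy c

-- Decidability of the existence of copies.

module _ (G : EdgeOrderedGraph k) (H : EdgeOrderedGraph n) where

  private
    IsCopy : (Fin k → Fin n) → Set
    IsCopy f =
      (∀ i j → f i ≡ f j → i ≡ j) ×
      (∀ i j → Adjacent G i j → Adjacent H (f i) (f j)) ×
      (∀ i j i′ j′ → Adjacent G i j → Adjacent G i′ j′ →
       label G i j < label G i′ j′ ⇔ label H (f i) (f j) < label H (f i′) (f j′))

    isCopy? : ∀ f → Dec (IsCopy f)
    isCopy? f =
      (Fin.all? λ i → Fin.all? λ j → (f i Fin.≟ f j) →-dec (i Fin.≟ j)) ×-dec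
      (Fin.all? λ i → Fin.all? λ j → adjacent? G i j →-dec adjacent? H (f i) (f j)) ×-dec
      order? G H f

    isCopy-resp : ∀ {f g} → f ≗ g → IsCopy f → IsCopy g
    isCopy-resp {f} {g} f≗g (inj , e , o) =
      (λ i j eq → inj i j (trans (f≗g i) (trans eq (sym (f≗g j))))) ,
      (λ i j a → subst₂ (Adjacent H) (f≗g i) (f≗g j) (e i j a)) ,
      λ i j i′ j′ a a′ → subst₂ (λ x y → _ ⇔ (x < y))
        (cong₂ (label H) (f≗g i) (f≗g j)) (cong₂ (label H) (f≗g i′) (f≗g j′)) (o i j i′ j′ a a′)

    fromIsCopy : ∀ {f} → IsCopy f → Copy G H
    fromIsCopy (inj , e , o) = record
      { injective = inj _ _ ; edges = e _ _ ; order = o _ _ _ _ }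

    toIsCopy : (c : Copy G H) → IsCopy (Copy.to c)
    toIsCopy c = (λ _ _ → Copy.injective c) , (λ _ _ → Copy.edges c) , (λ _ _ _ _ → Copy.order c)

  -- Maps are searched through their codes in `Fin (n ^ k)`. Decoding the code of a map returns it
  -- only up to pointwise equality, hence the condition that `R` respects `≗`.
  copyWith? : (R : (Fin k → Fin n) → Set) → (∀ f → Dec (R f)) →
              (∀ {f g} → f ≗ g → R f → R g) → Dec (Σ[ c ∈ Copy G H ] R (Copy.to c))
  copyWith? R R? R-resp = map′
    (λ (c , p , r) → fromIsCopy p , r)
    (λ (c , r) → let eq = λ i → sym (Fin.finToFun-funToFin (Copy.to c) i)
                 in funToFin (Copy.to c) , isCopy-resp eq (toIsCopy c) , R-resp eq r)
    (Fin.any? λ c → isCopy? (finToFun c) ×-dec R? (finToFun c))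

  copy? : Dec (Copy G H)
  copy? = map′ proj₁ (_, tt) (copyWith? (λ _ → ⊤) (λ _ → yes tt) (λ _ _ → tt))

  copyUsing? : ∀ u v → Dec (Σ[ c ∈ Copy G H ] Uses c u v)
  copyUsing? u v = copyWith? (λ f → ∃[ i ] ∃[ j ] (Adjacent G i j × f i ≡ u × f j ≡ v))
    (λ f → Fin.any? λ i → Fin.any? λ j →
       adjacent? G i j ×-dec ((f i Fin.≟ u) ×-dec (f j Fin.≟ v)))
    (λ f≗g (i , j , a , p , q) →
       i , j , a , trans (sym (f≗g i)) p , trans (sym (f≗g j)) q)

-- Finite search through edge-ordered graphs up to `≈`.

length-filter-⊆ : ∀ {A : Set} {P Q : Pred A 0ℓ} (P? : Decidable P) (Q? : Decidable Q) →
                  P ⊆ Q → ∀ xs → length (filter P? xs) ≤ length (filter Q? xs)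
length-filter-⊆ P? Q? P⊆Q [] = z≤n
length-filter-⊆ P? Q? P⊆Q (x ∷ xs) with P? x | Q? x
... | yes _  | yes _  = s≤s (length-filter-⊆ P? Q? P⊆Q xs)
... | yes p  | no ¬q  = contradiction (P⊆Q p) ¬q
... | no _   | yes _  = m≤n⇒m≤1+n (length-filter-⊆ P? Q? P⊆Q xs)
... | no _   | no _   = length-filter-⊆ P? Q? P⊆Q xs

length-filter-⊂ : ∀ {A : Set} {P Q : Pred A 0ℓ} (P? : Decidable P) (Q? : Decidable Q) →
                  P ⊆ Q → ∀ {x xs} → x ∈ xs → ¬ P x → Q x →
                  length (filter P? xs) < length (filter Q? xs)
length-filter-⊂ P? Q? P⊆Q {x} {xs = _ ∷ xs} (here refl) ¬p q with P? x | Q? x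
... | yes p  | _      = contradiction p ¬p
... | no _   | yes _  = s≤s (length-filter-⊆ P? Q? P⊆Q xs)
... | no _   | no ¬q  = contradiction q ¬q
length-filter-⊂ P? Q? P⊆Q {xs = y ∷ xs} (there x∈xs) ¬p q with P? y | Q? y
... | yes _  | yes _  = s≤s (length-filter-⊂ P? Q? P⊆Q x∈xs ¬p q)
... | yes p′ | no ¬q  = contradiction (P⊆Q p′) ¬q
... | no _   | yes _  = m≤n⇒m≤1+n (length-filter-⊂ P? Q? P⊆Q x∈xs ¬p q)
... | no _   | no _   = length-filter-⊂ P? Q? P⊆Q x∈xs ¬p q

pairs : ∀ n → List (Fin n × Fin n)
pairs n = cartesianProduct (allFin n) (allFin n)

∈-pairs : ∀ (i j : Fin n) → (i , j) ∈ pairs n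
∈-pairs i j = ∈-cartesianProduct⁺ (∈-allFin i) (∈-allFin j)

-- One function encodes both adjacency and labels, with 0 marking a non-edge, so that graphs can be
-- enumerated as functions.
IsLabelling : (Fin n → Fin n → ℕ) → Set
IsLabelling l =
  (∀ i j → l i j ≡ l j i) ×
  (∀ i → l i i ≡ 0) ×
  (∀ i j i′ j′ → T (0 <ᵇ l i j) → T (0 <ᵇ l i′ j′) → l i j ≡ l i′ j′ → SamePair i j i′ j′)

isLabelling? : (l : Fin n → Fin n → ℕ) → Dec (IsLabelling l)
isLabelling? l =
  (Fin.all? λ i → Fin.all? λ j → l i j ℕ.≟ l j i) ×-dec
  (Fin.all? λ i → l i i ℕ.≟ 0) ×-dec
  (Fin.all? λ i → Fin.all? λ j → Fin.all? λ i′ → Fin.all? λ j′ →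
    T? (0 <ᵇ l i j) →-dec (T? (0 <ᵇ l i′ j′) →-dec ((l i j ℕ.≟ l i′ j′) →-dec samePair? i j i′ j′)))

fromLabelling : (l : Fin n → Fin n → ℕ) → IsLabelling l → EdgeOrderedGraph n
fromLabelling l (l-sym , l-irr , l-inj) = record
  { adj       = λ i j → 0 <ᵇ l i j
  ; label     = l
  ; ~-sym     = λ {i} {j} → subst (T ∘ (0 <ᵇ_)) (l-sym i j)
  ; ~-irrefl  = λ { {i} refl → subst (T ∘ (0 <ᵇ_)) (l-irr i) }
  ; label-sym = λ {i} {j} _ → l-sym i j
  ; label-inj = λ {i} {j} {i′} {j′} → l-inj i j i′ j′
  }

-- Ranking the edges shows that labels at most 1 + n² suffice, so that up to ≈
-- there are only finitely many edge-ordered graphs.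
module Ranking (H : EdgeOrderedGraph n) where
  open EdgeOrderedGraph H using (_~_; ~-sym; ~-irrefl; label-sym; label-inj)

  Below : ℕ → Fin n × Fin n → Set
  Below m (i , j) = i ~ j × label H i j < m

  below? : ∀ m → Decidable (Below m)
  below? m (i , j) = adjacent? H i j ×-dec (label H i j ℕ.<? m)

  count : ℕ → ℕ
  count m = length (filter (below? m) (pairs n))

  count-mono-≤ : ∀ {m o} → m ≤ o → count m ≤ count o
  count-mono-≤ m≤o = length-filter-⊆ (below? _) (below? _) (λ (a , p) → a , ≤-trans p m≤o) (pairs n)

  count-mono-< : ∀ {i j m} → i ~ j → label H i j < m → count (label H i j) < count m
  count-mono-< {i} {j} a p =
    length-filter-⊂ (below? _) (below? _) (λ (b , q) → b , <-trans q p)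
      (∈-pairs i j) (λ (_ , q) → <-irrefl refl q) (a , p)

  count-reflects-< : ∀ {m o} → count m < count o → m < o
  count-reflects-< c = ℕ.≰⇒> λ o≤m → <⇒≱ c (count-mono-≤ o≤m)

  rank : Fin n → Fin n → ℕ
  rank i j with adjacent? H i j
  -- The successor keeps the rank of an edge away from 0, the mark of a non-edge.
  ... | yes _ = suc (count (label H i j))
  ... | no _  = 0

  rankBound : ℕ
  rankBound = 2 + length (pairs n)

  rank<bound : ∀ i j → rank i j < rankBound
  rank<bound i j with adjacent? H i j
  ... | yes _ = s≤s (s≤s (length-filter (below? _) (pairs n)))
  ... | no _  = s≤s z≤n

  rank-edge : ∀ {i j} → i ~ j → rank i j ≡ suc (count (label H i j))
  rank-edge {i} {j} a with adjacent? H i j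
  ... | yes _ = refl
  ... | no ¬a = contradiction a ¬a

  rank-nonEdge : ∀ {i j} → ¬ i ~ j → rank i j ≡ 0
  rank-nonEdge {i} {j} ¬a with adjacent? H i j
  ... | yes a = contradiction a ¬a
  ... | no _  = refl

  module _ (l : Fin n → Fin n → ℕ) (l≡rank : ∀ i j → l i j ≡ rank i j) where

    toEdge : ∀ {i j} → T (0 <ᵇ l i j) → i ~ j
    toEdge {i} {j} t with adjacent? H i j
    ... | yes a = a
    ... | no ¬a = ⊥-elim (subst (T ∘ (0 <ᵇ_)) (trans (l≡rank i j) (rank-nonEdge ¬a)) t)

    fromEdge : ∀ {i j} → i ~ j → T (0 <ᵇ l i j)
    fromEdge {i} {j} a = subst (T ∘ (0 <ᵇ_)) (sym (trans (l≡rank i j) (rank-edge a))) tt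

    l-edge : ∀ {i j} → i ~ j → l i j ≡ suc (count (label H i j))
    l-edge a = trans (l≡rank _ _) (rank-edge a)

    isLabelling : IsLabelling l
    isLabelling = l-sym , (λ i → trans (l≡rank i i) (rank-nonEdge (~-irrefl refl))) , l-inj
      where
      l-sym : ∀ i j → l i j ≡ l j i
      l-sym i j with adjacent? H i j
      ... | yes a = trans (l-edge a) (trans (cong (suc ∘ count) (label-sym a)) (sym (l-edge (~-sym a))))
      ... | no ¬a = trans (trans (l≡rank i j) (rank-nonEdge ¬a))
                          (sym (trans (l≡rank j i) (rank-nonEdge (¬a ∘ ~-sym))))

      l-inj : ∀ i j i′ j′ → T (0 <ᵇ l i j) → T (0 <ᵇ l i′ j′) → l i j ≡ l i′ j′ → SamePair i j i′ j′
      l-inj i j i′ j′ t t′ eq with <-cmp (label H i j) (label H i′ j′)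
      ... | tri≈ _ p _ = label-inj (toEdge t) (toEdge t′) p
      ... | tri< p _ _ = contradiction (count-mono-< (toEdge t) p)
              (<-irrefl (ℕ.suc-injective (trans (sym (l-edge (toEdge t))) (trans eq (l-edge (toEdge t′))))))
      ... | tri> _ _ p = contradiction (count-mono-< (toEdge t′) p)
              (<-irrefl (ℕ.suc-injective (trans (sym (l-edge (toEdge t′))) (trans (sym eq) (l-edge (toEdge t))))))

    l-order : ∀ {i j i′ j′} → i ~ j → i′ ~ j′ → label H i j < label H i′ j′ ⇔ l i j < l i′ j′
    l-order a a′ = mk⇔
      (λ p → subst₂ _<_ (sym (l-edge a)) (sym (l-edge a′)) (s≤s (count-mono-< a p)))
      (λ p → count-reflects-< (s<s⁻¹ (subst₂ _<_ (l-edge a) (l-edge a′) p)))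

    ranked≈ : (v : IsLabelling l) → fromLabelling l v ≈ H
    ranked≈ v =
      record { edges = toEdge ; order = λ e e′ → mk⇔ (from (l-order (toEdge e) (toEdge e′)))
                                                     (to (l-order (toEdge e) (toEdge e′))) } ,
      record { edges = fromEdge ; order = l-order }

module _ {P : Pred (EdgeOrderedGraph n) 0ℓ} (P? : Decidable P) (P-resp : ∀ {H K} → H ≈ K → P H → P K) where

  private
    M : ℕ
    M = 2 + length (pairs n)

    decode : Fin (M ^ (n * n)) → Fin n → Fin n → ℕ
    decode c i j = toℕ (finToFun c (combine i j))

    encode : EdgeOrderedGraph n → Fin (M ^ (n * n))
    encode H = funToFin (λ p → fromℕ< (uncurry (Ranking.rank<bound H) (remQuot n p)))

    decode-encode : ∀ H i j → decode (encode H) i j ≡ Ranking.rank H i j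
    decode-encode H i j = trans (cong toℕ (Fin.finToFun-funToFin _ (combine i j)))
      (trans (Fin.toℕ-fromℕ< _) (cong (uncurry (Ranking.rank H)) (Fin.remQuot-combine i j)))

    labelledWith? : ∀ l → Dec (Σ[ v ∈ IsLabelling l ] P (fromLabelling l v))
    labelledWith? l with isLabelling? l
    ... | no ¬v = no (¬v ∘ proj₁)
    -- The given proof of `IsLabelling l` may differ from `v`, but both yield the same edges and
    -- labels, hence equivalent graphs.
    ... | yes v = map′ (v ,_)
      (λ (_ , p) → P-resp (record { edges = id ; order = λ _ _ → mk⇔ id id } ,
                           record { edges = id ; order = λ _ _ → mk⇔ id id }) p)
      (P? (fromLabelling l v))

  anyGraph? : Dec (∃ P)
  anyGraph? = map′ (λ (_ , _ , p) → _ , p)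
    (λ (H , p) → let v = Ranking.isLabelling H _ (decode-encode H) in
      encode H , v , P-resp (≈-sym (Ranking.ranked≈ H _ (decode-encode H) v)) p)
    (Fin.any? (labelledWith? ∘ decode))

-- Existence of minimum edge numbers.

least : {P : Pred ℕ 0ℓ} → Decidable P → ∀ m → P m → ∃[ l ] (P l × ∀ k → P k → l ≤ k)
least P? m p with P? 0
least P? m p       | yes p₀ = 0 , p₀ , λ _ _ → z≤n
least P? zero p    | no ¬p₀ = contradiction p ¬p₀
least P? (suc m) p | no ¬p₀ =
  let l , pₗ , min = least (P? ∘ suc) m p in
  suc l , pₗ , λ { zero q → contradiction q ¬p₀ ; (suc k) q → s≤s (min k q) }

numEdges-≈ : {H K : EdgeOrderedGraph n} → H ≈ K → numEdges H ≡ numEdges K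
numEdges-≈ {n = n} (p , q) = cong length
  (filter-≐ _ _ ((λ (i<j , e) → i<j , _⊑_.edges p e) , (λ (i<j , e) → i<j , _⊑_.edges q e)) (pairs n))

-- Constructively, a minimum is found by testing edge counts from 0 upwards; each test is a finite
-- search, and the given graph guarantees success.
minNumEdges : {P : Pred (EdgeOrderedGraph n) 0ℓ} → Decidable P → (∀ {H K} → H ≈ K → P H → P K) →
              ∃ P → ∃ (IsMinNumEdges P)
minNumEdges P? P-resp (H , p) =
  let m , attained , min = least
        (λ m → anyGraph? (λ K → P? K ×-dec (numEdges K ℕ.≟ m))
                         (λ { eq (q , refl) → P-resp eq q , sym (numEdges-≈ eq) }))
        (numEdges H) (H , p , refl)
  in m , attained , λ K q → min (numEdges K) (K , q , refl)

-- Decidability of saturation, and saturated extensions.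

module _ (G : EdgeOrderedGraph k) where

  free? : (H : EdgeOrderedGraph n) → Dec (Free G H)
  free? H = ¬? (copy? G H)

  free-⊑ : H ⊑ K → Free G K → Free G H
  free-⊑ p free c = free (copy-⊑ p c)

  -- The quantifier over all insertions is decided as the absence of a bad insertion; decidability
  -- of copies using `uv` then removes the double negation.
  semisaturated? : (H : EdgeOrderedGraph n) → Dec (Semisaturated G H)
  semisaturated? H = map′
    (λ s u v u≢v ¬a K ins → decidable-stable (copyUsing? G K u v)
                              (λ ¬c → s u v u≢v ¬a (K , ins , ¬c)))
    (λ s u v u≢v ¬a (K , ins , ¬c) → ¬c (s u v u≢v ¬a K ins))
    (Fin.all? λ u → Fin.all? λ v → ¬? (u Fin.≟ v) →-dec (¬? (adjacent? H u v) →-dec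
      ¬? (anyGraph? (λ K → insertion? H u v K ×-dec ¬? (copyUsing? G K u v))
                    λ eq (ins , ¬c) → insertion-≈ eq ins , λ (c , uses) → ¬c (copy-⊑ (proj₂ eq) c , uses))))

  semisaturated-≈ : H ≈ K → Semisaturated G H → Semisaturated G K
  semisaturated-≈ eq s u v u≢v ¬a K′ ins =
    s u v u≢v (¬a ∘ _⊑_.edges (proj₁ eq)) K′ (insertion-resp-≈ (≈-sym eq) ins)

  saturated? : (H : EdgeOrderedGraph n) → Dec (Saturated G H)
  saturated? H = free? H ×-dec semisaturated? H

  saturated-≈ : H ≈ K → Saturated G H → Saturated G K
  saturated-≈ eq (f , s) = free-⊑ (proj₂ eq) f , semisaturated-≈ eq s

  -- A copy in `K` that avoids `uv` would lie entirely in `H`, which is free.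
  insertion-newCopy : ∀ {u v} → Free G H → Insertion H u v K → Copy G K → Σ[ c ∈ Copy G K ] Uses c u v
  insertion-newCopy {H = H} {K = K} {u = u} {v} free ins c =
    decidable-stable (copyUsing? G K u v) λ unused → free (restrict λ a p q → unused (c , _ , _ , a , p , q))
    where
    module c = Copy c
    restrict : (∀ {i j} → Adjacent G i j → c.to i ≡ u → c.to j ≡ v → ⊥) → Copy G H
    restrict unused = record
      { to        = c.to
      ; injective = c.injective
      ; edges     = edge
      ; order     = λ a a′ → ⇔-trans (c.order a a′)
          (mk⇔ (from (Insertion.order ins (edge a) (edge a′))) (to (Insertion.order ins (edge a) (edge a′))))
      }
      where
      edge : ∀ {i j} → Adjacent G i j → Adjacent H (c.to i) (c.to j)
      edge a with to (Insertion.edges ins _ _) (c.edges a)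
      ... | inj₁ e             = e
      ... | inj₂ (inj₁ (p , q)) = ⊥-elim (unused a p q)
      ... | inj₂ (inj₂ (p , q)) = ⊥-elim (unused (EdgeOrderedGraph.~-sym G a) q p)

  -- Further edges besides `uv` are allowed in the extension. The absence of one then passes to
  -- every larger graph by transitivity of `⊑`.
  FreeExtension : EdgeOrderedGraph n → Fin n → Fin n → Set
  FreeExtension H u v = ∃[ K ] (H ⊑ K × Adjacent K u v × Free G K)

  freeExtension? : (H : EdgeOrderedGraph n) → ∀ u v → Dec (FreeExtension H u v)
  freeExtension? H u v = anyGraph? (λ K → (H ⊑? K) ×-dec (adjacent? K u v ×-dec free? K))
    (λ eq (p , a , f) → ⊑-trans p (proj₁ eq) , _⊑_.edges (proj₁ eq) a , free-⊑ (proj₂ eq) f)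

  Settled : EdgeOrderedGraph n → Fin n × Fin n → Set
  Settled H (u , v) = Adjacent H u v ⊎ ¬ FreeExtension H u v

  settled-⊑ : ∀ {p} → H ⊑ K → Settled H p → Settled K p
  settled-⊑ p (inj₁ a) = inj₁ (_⊑_.edges p a)
  settled-⊑ p (inj₂ ¬ext) = inj₂ λ (K′ , q , rest) → ¬ext (K′ , ⊑-trans p q , rest)

  -- A settled pair stays settled in extensions, so one pass over the pairs suffices.
  settle : (H : EdgeOrderedGraph n) → Free G H → ∀ ps →
           ∃[ K ] (H ⊑ K × Free G K × ∀ {p} → p ∈ ps → Settled K p)
  settle H free [] = H , ⊑-refl , free , λ ()
  settle H free ((u , v) ∷ ps) with freeExtension? H u v
  ... | yes (K , H⊑K , a , freeK) =
    let K′ , K⊑K′ , freeK′ , settled = settle K freeK ps in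
    K′ , ⊑-trans H⊑K K⊑K′ , freeK′ ,
    λ { (here refl) → inj₁ (_⊑_.edges K⊑K′ a) ; (there p∈ps) → settled p∈ps }
  ... | no ¬ext =
    let K′ , H⊑K′ , freeK′ , settled = settle H free ps in
    K′ , H⊑K′ , freeK′ ,
    λ { (here refl) → settled-⊑ H⊑K′ (inj₂ ¬ext) ; (there p∈ps) → settled p∈ps }

  -- Once all pairs are settled, a non-edge has no free extension, so each of its insertions
  -- contains a copy; freeness before the insertion forces that copy to use the new edge.
  saturatedExtension : (H : EdgeOrderedGraph n) → Free G H → ∃[ K ] (H ⊑ K × Saturated G K)
  saturatedExtension {n = n} H free =
    let K , H⊑K , freeK , settled = settle H free (pairs n) in
    K , H⊑K , freeK , λ u v u≢v ¬a K′ ins → insertion-newCopy freeK ins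
      (decidable-stable (copy? G K′) λ freeK′ → fromSettled (settled (∈-pairs u v)) ¬a
        (K′ , insertion-⊑ ins , insertion-edge ins , freeK′))
    where
    fromSettled : ∀ {K : EdgeOrderedGraph n} {u v} → Settled K (u , v) →
                  ¬ Adjacent K u v → ¬ FreeExtension K u v
    fromSettled (inj₁ a) ¬a = contradiction a ¬a
    fromSettled (inj₂ ¬ext) _ = ¬ext

-- Bounding the number of edges by smaller endpoints.

length-filter-cartesianProduct :
  ∀ {A B : Set} {P : Pred (A × B) 0ℓ} {Q : Pred A 0ℓ} (P? : Decidable P) (Q? : Decidable Q) →
  (∀ {x y} → P (x , y) → Q x) → ∀ xs ys →
  length (filter P? (cartesianProduct xs ys)) ≤ length (filter Q? xs) * length ys
length-filter-cartesianProduct P? Q? P⇒Q [] ys = z≤n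
length-filter-cartesianProduct {P = P} P? Q? P⇒Q (x ∷ xs) ys = begin
  length (filter P? (row ++ rest))                ≡⟨ cong length (filter-++ P? row rest) ⟩
  length (filter P? row ++ filter P? rest)        ≡⟨ length-++ (filter P? row) ⟩
  length (filter P? row) + length (filter P? rest)
    ≤⟨ ℕ.+-monoʳ-≤ _ (length-filter-cartesianProduct P? Q? P⇒Q xs ys) ⟩
  length (filter P? row) + length (filter Q? xs) * length ys
    ≤⟨ first ⟩
  length (filter Q? (x ∷ xs)) * length ys ∎
  where
  open ≤-Reasoning
  row  = map (x ,_) ys
  rest = cartesianProduct xs ys

  first : length (filter P? row) + length (filter Q? xs) * length ys ≤ length (filter Q? (x ∷ xs)) * length ys
  first with Q? x
  ... | yes _ = ℕ.+-monoˡ-≤ _ (≤-trans (length-filter P? row) (≤-reflexive (length-map (x ,_) ys)))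
  ... | no ¬q = ≤-reflexive (cong (λ zs → length zs + length (filter Q? xs) * length ys)
    (filter-none P? (All.map⁺ (All.universal (λ y r → ¬q (P⇒Q r)) ys))))

length-filter-tabulate : ∀ {A : Set} {Q : Pred A 0ℓ} (Q? : Decidable Q) k {n} (f : Fin n → A) →
                         (∀ i → Q (f i) → toℕ i < k) → length (filter Q? (tabulate f)) ≤ k
length-filter-tabulate Q? k {zero} f Q⇒<k = z≤n
length-filter-tabulate Q? k {suc n} f Q⇒<k with Q? (f zero)
length-filter-tabulate Q? zero    {suc n} f Q⇒<k | yes q = contradiction (Q⇒<k zero q) λ ()
length-filter-tabulate Q? (suc k) {suc n} f Q⇒<k | yes q =
  s≤s (length-filter-tabulate Q? k (f ∘ suc) λ i p → s<s⁻¹ (Q⇒<k (suc i) p))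
length-filter-tabulate Q? k       {suc n} f Q⇒<k | no _ =
  length-filter-tabulate Q? k (f ∘ suc) λ i p → <-trans ≤-refl (Q⇒<k (suc i) p)

-- Each edge is counted once, in the row of its smaller endpoint; only `k` rows of length `n` can
-- contribute.
numEdges-≤ : (H : EdgeOrderedGraph n) → (∀ {i j} → toℕ i < toℕ j → Adjacent H i j → toℕ i < k) →
             numEdges H ≤ k * n
numEdges-≤ {n = n} {k = k} H edge⇒<k = begin
  numEdges H
    ≤⟨ length-filter-cartesianProduct _ row? (λ (i<j , e) → edge⇒<k i<j e) (allFin n) (allFin n) ⟩
  length (filter row? (allFin n)) * length (allFin n)
    ≤⟨ ℕ.*-mono-≤ (length-filter-tabulate row? k id (λ _ → id)) (≤-reflexive (length-tabulate {n = n} id)) ⟩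
  k * n ∎
  where
  open ≤-Reasoning
  row? : (i : Fin n) → Dec (toℕ i < k)
  row? i = toℕ i ℕ.<? k

-- Recognising a copy of `D₀`.

mono-< : (f : ℕ → ℕ) → (∀ m → f m < f (suc m)) → ∀ {m n} → m < n → f m < f n
mono-< f step {m} {suc n} m<1+n with ℕ.m<1+n⇒m<n∨m≡n m<1+n
... | inj₁ m<n  = <-trans (mono-< f step m<n) (step n)
... | inj₂ refl = step m

-- Adjacency separates every pair of vertices except `v`, `w`, and the four consecutive comparisons
-- determine the whole order through the increasing map `g`.
D₀-copy : ∀ {a b v w} → v ≢ w →
          Adjacent H a b → Adjacent H a v → Adjacent H a w → Adjacent H b w → Adjacent H b v →
          label H a b < label H a v → label H a v < label H a w →
          label H a w < label H b w → label H b w < label H b v → Copy D₀ H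
D₀-copy {H = H} {a} {b} {v} {w} v≢w ab av aw bw bv ab<av av<aw aw<bw bw<bv = record
  { to        = f
  ; injective = λ {i} {j} → injective i j
  ; edges     = λ {i} {j} → edges i j
  ; order     = λ {i} {j} {i′} {j′} e e′ → mk⇔ (order i j i′ j′ e e′) (reflect i j i′ j′ e e′)
  }
  where
  open EdgeOrderedGraph H using (~-sym; ~-irrefl; label-sym)

  f : Fin 4 → Fin _
  f = lookup (a Vec.∷ b Vec.∷ v Vec.∷ w Vec.∷ Vec.[])

  injective : ∀ i j → f i ≡ f j → i ≡ j
  injective 0F 0F _ = refl
  injective 0F 1F p = ⊥-elim (~-irrefl p ab)
  injective 0F 2F p = ⊥-elim (~-irrefl p av)
  injective 0F 3F p = ⊥-elim (~-irrefl p aw)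
  injective 1F 0F p = ⊥-elim (~-irrefl (sym p) ab)
  injective 1F 1F _ = refl
  injective 1F 2F p = ⊥-elim (~-irrefl p bv)
  injective 1F 3F p = ⊥-elim (~-irrefl p bw)
  injective 2F 0F p = ⊥-elim (~-irrefl (sym p) av)
  injective 2F 1F p = ⊥-elim (~-irrefl (sym p) bv)
  injective 2F 2F _ = refl
  injective 2F 3F p = contradiction p v≢w
  injective 3F 0F p = ⊥-elim (~-irrefl (sym p) aw)
  injective 3F 1F p = ⊥-elim (~-irrefl (sym p) bw)
  injective 3F 2F p = contradiction (sym p) v≢w
  injective 3F 3F _ = refl

  edges : ∀ i j → Adjacent D₀ i j → Adjacent H (f i) (f j)
  edges 0F 1F _ = ab
  edges 0F 2F _ = av
  edges 0F 3F _ = aw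
  edges 1F 0F _ = ~-sym ab
  edges 1F 2F _ = bv
  edges 1F 3F _ = bw
  edges 2F 0F _ = ~-sym av
  edges 2F 1F _ = ~-sym bv
  edges 2F 2F ()
  edges 2F 3F ()
  edges 3F 0F _ = ~-sym aw
  edges 3F 1F _ = ~-sym bw
  edges 3F 2F ()
  edges 3F 3F ()

  -- Continued beyond the five labels of D₀ so as to be increasing on all of ℕ.
  g : ℕ → ℕ
  g 0 = 0
  g 1 = label H a b
  g 2 = label H a v
  g 3 = label H a w
  g 4 = label H b w
  g (suc (suc (suc (suc (suc m))))) = m + label H b v

  g-step : ∀ m → g (suc m) < g (suc (suc m))
  g-step 0 = ab<av
  g-step 1 = av<aw
  g-step 2 = aw<bw
  g-step 3 = bw<bv
  g-step (suc (suc (suc (suc m)))) = ≤-refl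

  labels : ∀ i j → Adjacent D₀ i j → label H (f i) (f j) ≡ g (label D₀ i j)
  labels 0F 1F _ = refl
  labels 0F 2F _ = refl
  labels 0F 3F _ = refl
  labels 1F 0F _ = sym (label-sym ab)
  labels 1F 2F _ = refl
  labels 1F 3F _ = refl
  labels 2F 0F _ = sym (label-sym av)
  labels 2F 1F _ = sym (label-sym bv)
  labels 2F 2F ()
  labels 2F 3F ()
  labels 3F 0F _ = sym (label-sym aw)
  labels 3F 1F _ = sym (label-sym bw)
  labels 3F 2F ()
  labels 3F 3F ()

  g-mono-< : ∀ {x y} → T (0 <ᵇ x) → x < y → g x < g y
  g-mono-< {suc x} {suc y} _ x<y = mono-< (g ∘ suc) g-step (s<s⁻¹ x<y)

  order : ∀ i j i′ j′ → Adjacent D₀ i j → Adjacent D₀ i′ j′ →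
          label D₀ i j < label D₀ i′ j′ → label H (f i) (f j) < label H (f i′) (f j′)
  order i j i′ j′ e e′ p =
    subst₂ _<_ (sym (labels i j e)) (sym (labels i′ j′ e′)) (g-mono-< e p)

  reflect : ∀ i j i′ j′ → Adjacent D₀ i j → Adjacent D₀ i′ j′ →
            label H (f i) (f j) < label H (f i′) (f j′) → label D₀ i j < label D₀ i′ j′
  reflect i j i′ j′ e e′ p with <-cmp (label D₀ i j) (label D₀ i′ j′)
  ... | tri< q _ _ = q
  ... | tri≈ _ q _ = contradiction p
          (<-irrefl (trans (labels i j e) (trans (cong g q) (sym (labels i′ j′ e′)))))
  ... | tri> _ _ q = contradiction p (<-asym (order i′ j′ i j e′ e q))

-- A `D₀`-free graph whose free extensions have few edges.

module Construction (c K m : ℕ) (key : Fin m → Fin c → Fin K)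
  (key-injective : ∀ x → Injective _≡_ _≡_ (key x))
  (discordant : ∀ {x y} → x ≢ y →
     ∃[ v ] ∃[ w ] (toℕ (key x v) < toℕ (key x w) × toℕ (key y w) < toℕ (key y v)))
  where

  -- These are `p`, `q` and the `c` columns. They come first in the numbering, so an edge meeting
  -- them has its smaller index below `rows`.
  rows : ℕ
  rows = 2 + c

  Node : Set
  Node = Fin rows ⊎ Fin m

  pattern p     = inj₁ zero
  pattern q     = inj₁ (suc zero)
  pattern col j = inj₁ (suc (suc j))

  joined : Node → Node → Bool
  joined (inj₁ _) (inj₂ _) = true
  joined (inj₂ _) (inj₁ _) = true
  joined p q = true
  joined q p = true
  joined _ _ = false

  -- Position 0 of each block is reserved for the edge to `q`, ahead of all columns.
  key₊ : Fin m → Fin (suc c) → Fin (suc K)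
  key₊ x zero    = zero
  key₊ x (suc j) = suc (key x j)

  -- Values below `m` go to the edges at `p`, and `m` itself is left for `pq`. Above it follow
  -- blocks of length `suc K`, one for each `x`.
  rowLabel : Fin rows → Fin m → ℕ
  rowLabel zero    x = toℕ x
  rowLabel (suc i) x = suc m + toℕ (combine x (key₊ x i))

  nodeLabel : Node → Node → ℕ
  nodeLabel (inj₁ i) (inj₂ x) = rowLabel i x
  nodeLabel (inj₂ x) (inj₁ i) = rowLabel i x
  -- Among the remaining pairs only `pq` is an edge.
  nodeLabel _ _ = m

  joined-sym : ∀ s t → T (joined s t) → T (joined t s)
  joined-sym (inj₁ _) (inj₂ _) _ = tt
  joined-sym (inj₂ _) (inj₁ _) _ = tt
  joined-sym p q _ = tt
  joined-sym q p _ = tt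

  joined-irrefl : ∀ s → ¬ T (joined s s)
  joined-irrefl q ()

  nodeLabel-sym : ∀ s t → nodeLabel s t ≡ nodeLabel t s
  nodeLabel-sym (inj₁ _) (inj₁ _) = refl
  nodeLabel-sym (inj₁ _) (inj₂ _) = refl
  nodeLabel-sym (inj₂ _) (inj₁ _) = refl
  nodeLabel-sym (inj₂ _) (inj₂ _) = refl

  -- Edges without orientation, `nothing` standing for `pq`. Injectivity of labels is checked here
  -- and carried back to pairs of nodes by `edgeOf`.
  Edge : Set
  Edge = Maybe (Fin rows × Fin m)

  ends : Edge → Node × Node
  ends nothing        = p , q
  ends (just (i , x)) = inj₁ i , inj₂ x

  edgeLabel : Edge → ℕ
  edgeLabel nothing        = m
  edgeLabel (just (i , x)) = rowLabel i x

  key₊-injective : ∀ x {i j} → key₊ x i ≡ key₊ x j → i ≡ j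
  key₊-injective x {zero}  {zero}  eq = refl
  key₊-injective x {suc i} {suc j} eq = cong suc (key-injective x (Fin.suc-injective eq))

  low<high : ∀ {i x o} → o ≤ m → o < rowLabel (suc i) x
  low<high o≤m = s≤s (≤-trans o≤m (m≤m+n m _))

  rowLabel-injective : ∀ i x j y → rowLabel i x ≡ rowLabel j y → (i , x) ≡ (j , y)
  rowLabel-injective zero x zero y eq = cong (zero ,_) (Fin.toℕ-injective eq)
  rowLabel-injective zero x (suc j) y eq =
    contradiction (low<high {j} {y} (ℕ.<⇒≤ (Fin.toℕ<n x))) (<-irrefl eq)
  rowLabel-injective (suc i) x zero y eq =
    contradiction (low<high {i} {x} (ℕ.<⇒≤ (Fin.toℕ<n y))) (<-irrefl (sym eq))
  rowLabel-injective (suc i) x (suc j) y eq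
    with Fin.combine-injective x (key₊ x i) y (key₊ y j)
           (Fin.toℕ-injective (ℕ.+-cancelˡ-≡ (suc m) _ _ eq))
  ... | refl , eq′ = cong (λ i → suc i , x) (key₊-injective x eq′)

  m≢rowLabel : ∀ i x → m ≢ rowLabel i x
  m≢rowLabel zero    x eq = <-irrefl (sym eq) (Fin.toℕ<n x)
  m≢rowLabel (suc i) x eq = <-irrefl eq (low<high {i} {x} ≤-refl)

  edgeLabel-injective : ∀ d e → edgeLabel d ≡ edgeLabel e → d ≡ e
  edgeLabel-injective nothing nothing _ = refl
  edgeLabel-injective nothing (just (i , x)) eq = contradiction eq (m≢rowLabel i x)
  edgeLabel-injective (just (i , x)) nothing eq = contradiction (sym eq) (m≢rowLabel i x)
  edgeLabel-injective (just (i , x)) (just (j , y)) eq = cong just (rowLabel-injective i x j y eq)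

  edgeOf : ∀ s t → T (joined s t) →
           ∃[ e ] (nodeLabel s t ≡ edgeLabel e × (ends e ≡ (s , t) ⊎ ends e ≡ (t , s)))
  edgeOf (inj₁ i) (inj₂ x) _ = just (i , x) , refl , inj₁ refl
  edgeOf (inj₂ x) (inj₁ i) _ = just (i , x) , refl , inj₂ refl
  edgeOf p q _ = nothing , refl , inj₁ refl
  edgeOf q p _ = nothing , refl , inj₂ refl

  SameEnds : Node → Node → Node → Node → Set
  SameEnds s t s′ t′ = (s ≡ s′ × t ≡ t′) ⊎ (s ≡ t′ × t ≡ s′)

  sameEnds : ∀ {e s t s′ t′} → e ≡ (s , t) ⊎ e ≡ (t , s) → e ≡ (s′ , t′) ⊎ e ≡ (t′ , s′) →
             SameEnds s t s′ t′
  sameEnds (inj₁ refl) (inj₁ refl) = inj₁ (refl , refl)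
  sameEnds (inj₁ refl) (inj₂ refl) = inj₂ (refl , refl)
  sameEnds (inj₂ refl) (inj₁ refl) = inj₂ (refl , refl)
  sameEnds (inj₂ refl) (inj₂ refl) = inj₁ (refl , refl)

  nodeLabel-injective : ∀ s t s′ t′ → T (joined s t) → T (joined s′ t′) →
                        nodeLabel s t ≡ nodeLabel s′ t′ → SameEnds s t s′ t′
  nodeLabel-injective s t s′ t′ a a′ eq with edgeOf s t a | edgeOf s′ t′ a′
  ... | e , l , ends-e | e′ , l′ , ends-e′
    with refl ← edgeLabel-injective e e′ (trans (sym l) (trans eq l′)) = sameEnds ends-e ends-e′

  node : Fin (rows + m) → Node
  node = splitAt rows

  vertex : Node → Fin (rows + m)
  vertex = join rows m

  node-injective : ∀ {i j} → node i ≡ node j → i ≡ j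
  node-injective {i} {j} eq =
    trans (sym (Fin.join-splitAt rows m i)) (trans (cong vertex eq) (Fin.join-splitAt rows m j))

  base : EdgeOrderedGraph (rows + m)
  base = record
    { adj       = λ i j → joined (node i) (node j)
    ; label     = λ i j → nodeLabel (node i) (node j)
    ; ~-sym     = λ {i} {j} → joined-sym (node i) (node j)
    ; ~-irrefl  = λ { {i} refl → joined-irrefl (node i) }
    ; label-sym = λ {i} {j} _ → nodeLabel-sym (node i) (node j)
    ; label-inj = λ {i} {j} {i′} {j′} a a′ eq →
        [ (λ (u , v) → inj₁ (node-injective u , node-injective v))
        , (λ (u , v) → inj₂ (node-injective u , node-injective v)) ]′
        (nodeLabel-injective (node i) (node j) (node i′) (node j′) a a′ eq)
    }

  -- Every triangle consists of `p`, `q` and some `x`. As `px` precedes `pq`, the least edge `ab` is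
  -- not `pq`, so it joins `x` to one of `p`, `q`, and the other one is the only common neighbour of
  -- `a` and `b`.
  noD₀ : ∀ a b v w → T (joined a b) → T (joined a v) → T (joined b v) → T (joined a w) →
         T (joined b w) → nodeLabel a b < nodeLabel a v → nodeLabel a b < nodeLabel b v → v ≡ w
  noD₀ p q (inj₂ x) w _ _ _ _ _ m<px _ = contradiction m<px (<-asym (Fin.toℕ<n x))
  noD₀ q p (inj₂ x) w _ _ _ _ _ _ m<px = contradiction m<px (<-asym (Fin.toℕ<n x))
  noD₀ p q p _ _ ()
  noD₀ p q q _ _ _ ()
  noD₀ p q (col _) _ _ ()
  noD₀ q p p _ _ _ ()
  noD₀ q p q _ _ ()
  noD₀ q p (col _) _ _ ()
  noD₀ p (inj₂ x) q q _ _ _ _ _ _ _ = refl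
  noD₀ q (inj₂ x) p p _ _ _ _ _ _ _ = refl
  noD₀ (inj₂ x) p q q _ _ _ _ _ _ _ = refl
  noD₀ (inj₂ x) q p p _ _ _ _ _ _ _ = refl

  base-free : Free D₀ base
  base-free c = contradiction
    (c.injective (node-injective (noD₀ (f 0F) (f 1F) (f 2F) (f 3F)
      (c.edges {0F} {1F} tt) (c.edges {0F} {2F} tt) (c.edges {1F} {2F} tt)
      (c.edges {0F} {3F} tt) (c.edges {1F} {3F} tt)
      (to (c.order {0F} {1F} {0F} {2F} tt tt) (s≤s (s≤s z≤n)))
      (to (c.order {0F} {1F} {1F} {2F} tt tt) (s≤s (s≤s z≤n)))))) λ ()
    where
    module c = Copy c
    f = node ∘ c.to

  base-edge : ∀ s t → T (joined s t) → Adjacent base (vertex s) (vertex t)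
  base-edge s t = subst₂ (λ s t → T (joined s t))
    (sym (Fin.splitAt-join rows m s)) (sym (Fin.splitAt-join rows m t))

  base-label : ∀ s t → label base (vertex s) (vertex t) ≡ nodeLabel s t
  base-label s t = cong₂ nodeLabel (Fin.splitAt-join rows m s) (Fin.splitAt-join rows m t)

  block-< : ∀ {x y i j} → toℕ x < toℕ y → rowLabel (suc i) x < rowLabel (suc j) y
  block-< {x} {y} {i} {j} x<y = ℕ.+-monoʳ-< (suc m) (Fin.combine-monoˡ-< (key₊ x i) (key₊ y j) x<y)

  key-< : ∀ {x i j} → toℕ (key₊ x i) < toℕ (key₊ x j) → rowLabel (suc i) x < rowLabel (suc j) x
  key-< {x} {i} {j} i<j = ℕ.+-monoʳ-< (suc m) (subst₂ _<_
    (sym (Fin.toℕ-combine x (key₊ x i))) (sym (Fin.toℕ-combine x (key₊ x j)))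
    (ℕ.+-monoʳ-< (suc K * toℕ x) i<j))

  module _ {H : EdgeOrderedGraph (rows + m)} (base⊑H : base ⊑ H) where

    private
      edge : ∀ s t → T (joined s t) → Adjacent H (vertex s) (vertex t)
      edge s t e = _⊑_.edges base⊑H (base-edge s t e)

      order : ∀ s t s′ t′ → T (joined s t) → T (joined s′ t′) → nodeLabel s t < nodeLabel s′ t′ →
              label H (vertex s) (vertex t) < label H (vertex s′) (vertex t′)
      order s t s′ t′ e e′ = to (_⊑_.order base⊑H (base-edge s t e) (base-edge s′ t′ e′))
        ∘ subst₂ _<_ (sym (base-label s t)) (sym (base-label s′ t′))

    copyFromNewEdge : ∀ {x y} → toℕ x < toℕ y →
                      Adjacent H (vertex (inj₂ x)) (vertex (inj₂ y)) → Copy D₀ H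
    copyFromNewEdge {x} {y} x<y xy
      with label H (vertex (inj₂ x)) (vertex q) ℕ.<? label H (vertex (inj₂ x)) (vertex (inj₂ y))
    ... | yes xq<xy = D₀-copy (λ ())
      (edge p (inj₂ x) tt) (edge p (inj₂ y) tt) (edge p q tt) (edge (inj₂ x) q tt) xy
      (order p (inj₂ x) p (inj₂ y) tt tt x<y)
      (order p (inj₂ y) p q tt tt (Fin.toℕ<n y))
      (order p q (inj₂ x) q tt tt (low<high {zero} {x} ≤-refl))
      xq<xy
    ... | no xq≮xy with discordant (λ x≡y → <-irrefl (cong toℕ x≡y) x<y)
    ... | v , w , xv<xw , yw<yv = D₀-copy
      (λ v≡w → <-irrefl (cong (label H (vertex (inj₂ x))) v≡w) lxv<lxw)
      xy (edge (inj₂ x) (col v) tt) (edge (inj₂ x) (col w) tt)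
      (edge (inj₂ y) (col w) tt) (edge (inj₂ y) (col v) tt)
      -- Here `xy` is at or below `xq`, which opens the block of `x` and so precedes the edges from
      -- `x` to all columns.
      (≤-<-trans (ℕ.≮⇒≥ xq≮xy)
        (order (inj₂ x) q (inj₂ x) (col v) tt tt (key-< {x} {zero} {suc v} z<s)))
      lxv<lxw
      (order (inj₂ x) (col w) (inj₂ y) (col w) tt tt (block-< {i = suc w} {suc w} x<y))
      (order (inj₂ y) (col w) (inj₂ y) (col v) tt tt (key-< {y} {suc w} {suc v} (s≤s yw<yv)))
      where
      lxv<lxw = order (inj₂ x) (col v) (inj₂ x) (col w) tt tt (key-< {x} {suc v} {suc w} (s≤s xv<xw))

    -- An edge inside the independent set would produce a copy; any other edge has an end among the
    -- rows, whose indices come first.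
    edge⇒row : Free D₀ H → ∀ {i j} → toℕ i < toℕ j → Adjacent H i j → toℕ i < rows
    edge⇒row free {i} {j} i<j a
      with splitAt rows i in i≡ | splitAt rows j in j≡
    ... | inj₁ r | _ = subst (λ i → toℕ i < rows) (Fin.splitAt⁻¹-↑ˡ i≡)
                         (≤-<-trans (≤-reflexive (Fin.toℕ-↑ˡ r m)) (Fin.toℕ<n r))
    ... | inj₂ x | inj₁ r = <-trans i<j (subst (λ j → toℕ j < rows) (Fin.splitAt⁻¹-↑ˡ j≡)
                         (≤-<-trans (≤-reflexive (Fin.toℕ-↑ˡ r m)) (Fin.toℕ<n r)))
    ... | inj₂ x | inj₂ y
      with refl ← Fin.splitAt⁻¹-↑ʳ {m = rows} {i = i} i≡
         | refl ← Fin.splitAt⁻¹-↑ʳ {m = rows} {i = j} j≡ =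
      ⊥-elim (free (copyFromNewEdge (ℕ.+-cancelˡ-< rows _ _
        (subst₂ _<_ (Fin.toℕ-↑ʳ rows x) (Fin.toℕ-↑ʳ rows y) i<j)) a))

  smallSaturated : ∃[ H ] (Saturated D₀ H × numEdges H ≤ rows * (rows + m))
  smallSaturated =
    let H , base⊑H , saturated = saturatedExtension D₀ base base-free
    in H , saturated , numEdges-≤ H (edge⇒row base⊑H (proj₁ saturated))

-- Pairwise discordant column orders from base-`s` digits.

funToFin-cong : ∀ {m n} {f g : Fin m → Fin n} → f ≗ g → funToFin f ≡ funToFin g
funToFin-cong {zero}  f≗g = refl
funToFin-cong {suc m} f≗g = cong₂ combine (f≗g zero) (funToFin-cong (f≗g ∘ suc))

-- The columns are s markers and t digits.  In the permutation belonging to x the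
-- markers appear in their natural order and the d-th digit column sits between
-- the marker given by the d-th base-s digit of x and the next one; so if x and y
-- differ in that digit then some marker switches sides of the d-th digit column.
module Digits {s t m : ℕ} (m≤s^t : m ≤ s ^ t) where

  digit : Fin m → Fin t → Fin s
  digit x = finToFun (inject≤ x m≤s^t)

  -- A number is recovered from its digits, so distinct numbers cannot agree in all of them;
  -- decidability of equality locates a difference.
  digits-distinct : ∀ {x y} → x ≢ y → ∃[ d ] digit x d ≢ digit y d
  digits-distinct {x} {y} x≢y = Fin.¬∀⟶∃¬ t _ (λ d → digit x d Fin.≟ digit y d) λ eq →
    x≢y (Fin.inject≤-injective m≤s^t m≤s^t x y
      (trans (sym (Fin.funToFin-finToFin {t} {s} _)) (trans (funToFin-cong eq) (Fin.funToFin-finToFin {t} {s} _))))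

  -- The positions form `s` blocks of length `suc t`. Marker `i` opens block `i`, and offset `suc d`
  -- is reserved for digit column `d`, so no two columns collide.
  place : Fin m → Fin s ⊎ Fin t → Fin (s * suc t)
  place x (inj₁ i) = combine i zero
  place x (inj₂ d) = combine (digit x d) (suc d)

  place-injective : ∀ x {u v} → place x u ≡ place x v → u ≡ v
  place-injective x {inj₁ i} {inj₁ j} eq = cong inj₁ (Fin.combine-injectiveˡ i zero j zero eq)
  place-injective x {inj₁ i} {inj₂ d} eq =
    contradiction (Fin.combine-injectiveʳ i zero (digit x d) (suc d) eq) λ ()
  place-injective x {inj₂ d} {inj₁ j} eq =
    contradiction (Fin.combine-injectiveʳ (digit x d) (suc d) j zero eq) λ ()
  place-injective x {inj₂ d} {inj₂ e} eq =
    cong inj₂ (Fin.suc-injective (Fin.combine-injectiveʳ (digit x d) (suc d) (digit x e) (suc e) eq))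

  marker<digit : ∀ x d → toℕ (place x (inj₁ (digit x d))) < toℕ (place x (inj₂ d))
  marker<digit x d = subst₂ _<_ (sym (Fin.toℕ-combine (digit x d) zero)) (sym (Fin.toℕ-combine (digit x d) (suc d)))
    (ℕ.+-monoʳ-< (suc t * toℕ (digit x d)) z<s)

  digit<marker : ∀ {x d i} → toℕ (digit x d) < toℕ i → toℕ (place x (inj₂ d)) < toℕ (place x (inj₁ i))
  digit<marker {d = d} = Fin.combine-monoˡ-< (suc d) zero

  place-discordant : ∀ {x y} → x ≢ y →
    ∃[ u ] ∃[ v ] (toℕ (place x u) < toℕ (place x v) × toℕ (place y v) < toℕ (place y u))
  place-discordant {x} {y} x≢y with digits-distinct x≢y
  ... | d , x_d≢y_d with <-cmp (toℕ (digit x d)) (toℕ (digit y d))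
  -- The marker that switches sides is that of the larger digit: column `d` lies before it under the
  -- smaller digit and after it under the larger.
  ... | tri< lt _ _ = inj₂ d , inj₁ (digit y d) , digit<marker lt , marker<digit y d
  ... | tri≈ _ eq _ = contradiction (Fin.toℕ-injective eq) x_d≢y_d
  ... | tri> _ _ gt = inj₁ (digit x d) , inj₂ d , marker<digit x d , digit<marker gt

  key : Fin m → Fin (s + t) → Fin (s * suc t)
  key x = place x ∘ splitAt s

  key-injective : ∀ x → Injective _≡_ _≡_ (key x)
  key-injective x {i} {j} eq = trans (sym (Fin.join-splitAt s t i))
    (trans (cong (join s t) (place-injective x {splitAt s i} {splitAt s j} eq)) (Fin.join-splitAt s t j))

  key-join : ∀ x u → key x (join s t u) ≡ place x u
  key-join x u = cong (place x) (Fin.splitAt-join s t u)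

  discordant : ∀ {x y} → x ≢ y →
    ∃[ v ] ∃[ w ] (toℕ (key x v) < toℕ (key x w) × toℕ (key y w) < toℕ (key y v))
  discordant {x} {y} x≢y =
    let u , v , lt , gt = place-discordant x≢y in
    join s t u , join s t v ,
    subst₂ _<_ (sym (cong toℕ (key-join x u))) (sym (cong toℕ (key-join x v))) lt ,
    subst₂ _<_ (sym (cong toℕ (key-join y v))) (sym (cong toℕ (key-join y u))) gt

  open Construction (s + t) (s * suc t) m key key-injective discordant public using (smallSaturated)

-- Saturated graphs with few edges on any number of vertices.

freeGraph : ∀ n → ∃ (Free {n = n} D₀)
freeGraph n = empty , λ c → Copy.edges c {0F} {1F} tt
  where
  empty : EdgeOrderedGraph n
  empty = record
    { adj = λ _ _ → false ; label = λ _ _ → 0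
    ; ~-sym = λ () ; ~-irrefl = λ _ () ; label-sym = λ () ; label-inj = λ () }

anySaturated : ∀ n → ∃ (Saturated {n = n} D₀)
anySaturated n =
  let _ , free = freeGraph n
      H , _ , saturated = saturatedExtension D₀ _ free
  in H , saturated

fewEdges : ∀ {n} s t → n ≤ s ^ t → Σ[ H ∈ EdgeOrderedGraph n ] (Saturated D₀ H × numEdges H ≤ (2 + (s + t)) * n)
fewEdges {n} s t n≤s^t with 2 + (s + t) ℕ.≤? n
-- Here `n` is below `2 + (s + t)`, so every index is small enough and any saturated graph will do.
... | no ¬p =
  let H , saturated = anySaturated n in
  H , saturated , numEdges-≤ H λ {i} _ _ → <-trans (Fin.toℕ<n i) (ℕ.≰⇒> ¬p)
... | yes p with ℕ.m≤n⇒∃[o]m+o≡n p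
-- The `m` vertices left after `p`, `q` and the columns form the independent set, and
-- `m ≤ n ≤ s ^ t` supplies enough digit strings.
... | m , refl = Digits.smallSaturated {s} {t} (≤-trans (ℕ.m≤n+m m (2 + (s + t))) n≤s^t)

-- Logarithm estimates and the choice of parameters.

n<2^n : ∀ n → n < 2 ^ n
n<2^n zero    = z<s
n<2^n (suc n) = ℕ.+-mono-≤ (≤-trans (s≤s z≤n) (n<2^n n))
  (≤-trans (n<2^n n) (≤-reflexive (sym (ℕ.+-identityʳ _))))

n<2^[1+log₂n] : ∀ n → n < 2 ^ suc ⌊log₂ n ⌋
n<2^[1+log₂n] n = ℕ.≰⇒> λ le → <-irrefl refl
  (≤-trans (≤-reflexive (sym (⌊log₂[2^n]⌋≡n (suc ⌊log₂ n ⌋)))) (⌊log₂⌋-mono-≤ le))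

1+log₂⌊n/2⌋ : ∀ n → 2 ≤ n → suc ⌊log₂ ⌊ n /2⌋ ⌋ ≡ ⌊log₂ n ⌋
1+log₂⌊n/2⌋ n 2≤n = trans (cong suc (⌊log₂⌊n/2⌋⌋≡⌊log₂n⌋∸1 n))
  (ℕ.m+[n∸m]≡n (≤-trans (≤-reflexive (sym (⌊log₂[2^n]⌋≡n 1))) (⌊log₂⌋-mono-≤ 2≤n)))

⌊n/2⌋+⌊n/2⌋≤n : ∀ n → ⌊ n /2⌋ + ⌊ n /2⌋ ≤ n
⌊n/2⌋+⌊n/2⌋≤n n = ≤-trans (ℕ.+-monoʳ-≤ _ (ℕ.⌊n/2⌋≤⌈n/2⌉ n)) (≤-reflexive (ℕ.⌊n/2⌋+⌈n/2⌉≡n n))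

n≤1+⌊n/2⌋+⌊n/2⌋ : ∀ n → n ≤ suc (⌊ n /2⌋ + ⌊ n /2⌋)
n≤1+⌊n/2⌋+⌊n/2⌋ n = ≤-trans (≤-reflexive (sym (ℕ.⌊n/2⌋+⌈n/2⌉≡n n)))
  (≤-trans (ℕ.+-monoʳ-≤ ⌊ n /2⌋ (ℕ.⌊n/2⌋-mono (ℕ.n≤1+n (suc n)))) (≤-reflexive (ℕ.+-suc _ _)))

-- Halving lowers the floored logarithm by one, so strong induction passes from `⌊ n /2⌋` to `n`.
2^log₂n≤n : ∀ n → 1 ≤ n → 2 ^ ⌊log₂ n ⌋ ≤ n
2^log₂n≤n = <-rec _ step
  where
  open ≤-Reasoning
  step : ∀ n → (∀ {m} → m < n → 1 ≤ m → 2 ^ ⌊log₂ m ⌋ ≤ m) → 1 ≤ n → 2 ^ ⌊log₂ n ⌋ ≤ n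
  step 1 _ _ = ≤-refl
  step n@(suc (suc k)) rec _ = begin
    2 ^ ⌊log₂ n ⌋              ≡⟨ cong (2 ^_) (1+log₂⌊n/2⌋ n (s≤s (s≤s z≤n))) ⟨
    2 * 2 ^ ⌊log₂ ⌊ n /2⌋ ⌋    ≤⟨ ℕ.*-monoʳ-≤ 2 (rec (ℕ.⌊n/2⌋<n (suc k)) (s≤s z≤n)) ⟩
    2 * ⌊ n /2⌋                ≡⟨ cong (⌊ n /2⌋ +_) (ℕ.+-identityʳ _) ⟩
    ⌊ n /2⌋ + ⌊ n /2⌋          ≤⟨ ⌊n/2⌋+⌊n/2⌋≤n n ⟩
    n ∎

-- From 16 on, `L ≥ 4` and `ℓ ≥ 2`, hence `r ≥ 1` and division by `r` makes sense.
module Parameters (n : ℕ) (16≤n : 16 ≤ n) where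
  L ℓ r s t : ℕ
  L = ⌊log₂ n ⌋
  ℓ = ⌊log₂ L ⌋
  r = ⌊ ℓ /2⌋

  4≤L : 4 ≤ L
  4≤L = ≤-trans (≤-reflexive (sym (⌊log₂[2^n]⌋≡n 4))) (⌊log₂⌋-mono-≤ 16≤n)

  2≤ℓ : 2 ≤ ℓ
  2≤ℓ = ≤-trans (≤-reflexive (sym (⌊log₂[2^n]⌋≡n 2))) (⌊log₂⌋-mono-≤ 4≤L)

  1≤r : 1 ≤ r
  1≤r = ℕ.⌊n/2⌋-mono 2≤ℓ

  1≤L : 1 ≤ L
  1≤L = ≤-trans (s≤s z≤n) 4≤L

  instance
    r≢0 : NonZero r
    r≢0 = >-nonZero 1≤r

  -- With s ≈ √L, both the s markers and the t ≈ L / log s digits number O(L / ℓ).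
  s = 2 ^ r
  t = suc (suc L / r)

  open ≤-Reasoning

  n≤s^t : n ≤ s ^ t
  n≤s^t = begin
    n             ≤⟨ <⇒≤ (n<2^[1+log₂n] n) ⟩
    2 ^ suc L     ≤⟨ ℕ.^-monoʳ-≤ 2 1+L≤rt ⟩
    2 ^ (r * t)   ≡⟨ ℕ.^-*-assoc 2 r t ⟨
    s ^ t ∎
    where
    1+L≤rt : suc L ≤ r * t
    1+L≤rt = begin
      suc L                       ≡⟨ m≡m%n+[m/n]*n (suc L) r ⟩
      -- The extra unit in `t` pays for the remainder modulo `r`.
      suc L % r + suc L / r * r   ≤⟨ ℕ.+-monoˡ-≤ _ (<⇒≤ (m%n<n (suc L) r)) ⟩
      t * r                       ≡⟨ ℕ.*-comm t r ⟩
      r * t ∎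

  2^ℓ≤L : 2 ^ ℓ ≤ L
  2^ℓ≤L = 2^log₂n≤n L 1≤L

  ℓ≤L : ℓ ≤ L
  ℓ≤L = ≤-trans (<⇒≤ (n<2^n ℓ)) 2^ℓ≤L

  -- On one side `ℓ ≤ 2r + 1 ≤ 2s`; on the other `s * s = 2 ^ (r + r) ≤ 2 ^ ℓ ≤ L`.
  sℓ≤2L : s * ℓ ≤ 2 * L
  sℓ≤2L = begin
    s * ℓ               ≤⟨ ℕ.*-monoʳ-≤ s (n≤1+⌊n/2⌋+⌊n/2⌋ ℓ) ⟩
    s * suc (r + r)     ≤⟨ ℕ.*-monoʳ-≤ s (ℕ.+-mono-≤ (n<2^n r) (<⇒≤ (n<2^n r))) ⟩
    s * (s + s)         ≡⟨ solve 1 (λ s → s :* (s :+ s) := con 2 :* (s :* s)) refl s ⟩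
    2 * (s * s)         ≡⟨ cong (2 *_) (ℕ.^-distribˡ-+-* 2 r r) ⟨
    2 * 2 ^ (r + r)     ≤⟨ ℕ.*-monoʳ-≤ 2 (ℕ.^-monoʳ-≤ 2 (⌊n/2⌋+⌊n/2⌋≤n ℓ)) ⟩
    2 * 2 ^ ℓ           ≤⟨ ℕ.*-monoʳ-≤ 2 2^ℓ≤L ⟩
    2 * L ∎
    where open +-*-Solver

  tr≤3L : t * r ≤ 3 * L
  -- By definition `t * r` is `r + suc L / r * r`; the summands are at most `L` and `2 * L`.
  tr≤3L = ℕ.+-mono-≤ (≤-trans (ℕ.⌊n/2⌋≤n ℓ) ℓ≤L) (begin
    suc L / r * r   ≤⟨ m/n*n≤m (suc L) r ⟩
    suc L           ≤⟨ ℕ.+-monoˡ-≤ L 1≤L ⟩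
    L + L           ≡⟨ cong (L +_) (ℕ.+-identityʳ L) ⟨
    2 * L ∎)

  -- Since `r ≥ 1`, `ℓ ≤ 2r + 1 ≤ 3r`, which triples the bound on `t * r`.
  tℓ≤9L : t * ℓ ≤ 9 * L
  tℓ≤9L = begin
    t * ℓ             ≤⟨ ℕ.*-monoʳ-≤ t (n≤1+⌊n/2⌋+⌊n/2⌋ ℓ) ⟩
    t * suc (r + r)   ≤⟨ ℕ.*-monoʳ-≤ t (ℕ.+-monoˡ-≤ (r + r) 1≤r) ⟩
    t * (r + (r + r)) ≡⟨ solve 2 (λ t r → t :* (r :+ (r :+ r)) := con 3 :* (t :* r)) refl t r ⟩
    3 * (t * r)       ≤⟨ ℕ.*-monoʳ-≤ 3 tr≤3L ⟩
    3 * (3 * L)       ≡⟨ ℕ.*-assoc 3 3 L ⟨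
    9 * L ∎
    where open +-*-Solver

  -- The constant is 2 for `p` and `q`, plus 2 for the markers, plus 9 for the digit columns.
  rows*ℓ≤13L : (2 + (s + t)) * ℓ ≤ 13 * L
  rows*ℓ≤13L = begin
    (2 + (s + t)) * ℓ
      ≡⟨ solve 3 (λ s t ℓ → (con 2 :+ (s :+ t)) :* ℓ
           := con 2 :* ℓ :+ (s :* ℓ :+ t :* ℓ)) refl s t ℓ ⟩
    2 * ℓ + (s * ℓ + t * ℓ)    ≤⟨ ℕ.+-mono-≤ (ℕ.*-monoʳ-≤ 2 ℓ≤L) (ℕ.+-mono-≤ sℓ≤2L tℓ≤9L) ⟩
    2 * L + (2 * L + 9 * L)
      ≡⟨ solve 1 (λ L → con 2 :* L :+ (con 2 :* L :+ con 9 :* L) := con 13 :* L) refl L ⟩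
    13 * L ∎
    where open +-*-Solver

  saturatedUpperBound : ∀ {m} → Is-satₑ n D₀ m → m * ℓ ≤ 13 * (n * L)
  saturatedUpperBound {m} (_ , min) =
    let H , saturated , few = fewEdges s t n≤s^t in begin
    m * ℓ                       ≤⟨ ℕ.*-monoˡ-≤ ℓ (≤-trans (min H saturated) few) ⟩
    (2 + (s + t)) * n * ℓ       ≡⟨ solve 3 (λ k n ℓ → k :* n :* ℓ := k :* ℓ :* n) refl (2 + (s + t)) n ℓ ⟩
    (2 + (s + t)) * ℓ * n       ≤⟨ ℕ.*-monoˡ-≤ n rows*ℓ≤13L ⟩
    13 * L * n                  ≡⟨ solve 2 (λ L n → con 13 :* L :* n := con 13 :* (n :* L)) refl L n ⟩
    13 * (n * L) ∎
    where open +-*-Solver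

-- Existence of both minima, their comparison and the bound.

minSaturated : ∀ n → ∃ (Is-satₑ n D₀)
minSaturated n = minNumEdges (saturated? D₀) (saturated-≈ D₀) (anySaturated n)

minSemisaturated : ∀ n → ∃ (Is-ssatₑ n D₀)
minSemisaturated n =
  let H , _ , semisaturated = anySaturated n
  in minNumEdges (semisaturated? D₀) (semisaturated-≈ D₀) (H , semisaturated)

-- A minimal saturated graph is itself a competitor for the semisaturated minimum.
ssat≤sat : ∀ {n k l} → Is-ssatₑ n D₀ k → Is-satₑ n D₀ l → k ≤ l
ssat≤sat (_ , min) ((H , (_ , semisaturated) , refl) , _) = min H semisaturated

theorem54 : Σ[ ssatₑ ∈ (ℕ → ℕ) ] Σ[ satₑ ∈ (ℕ → ℕ) ]
    ((∀ n → Is-ssatₑ n D₀ (ssatₑ n)) ×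
    (∀ n → Is-satₑ n D₀ (satₑ n)) ×
    (∀ n → ssatₑ n ≤ satₑ n) ×
    IsO[n·log/loglog] satₑ)
theorem54 =
  (λ n → proj₁ (minSemisaturated n)) , (λ n → proj₁ (minSaturated n)) ,
  (λ n → proj₂ (minSemisaturated n)) , (λ n → proj₂ (minSaturated n)) ,
  (λ n → ssat≤sat (proj₂ (minSemisaturated n)) (proj₂ (minSaturated n))) ,
  13 , 16 , λ n 16≤n → Parameters.saturatedUpperBound n 16≤n (proj₂ (minSaturated n))
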